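{- Let $n>2$ be an integer, $N=n(n-1)/2$ and $N'=(n-1)(n-2)/2$. Then the $n-2$ highest-degree terms of the flow polynomial $F_{K_n}(x)$ of the complete graph $K_n$ are $$x^{N'}-N x^{N'-1}+\binom{N}{2}x^{N'-2}-\ldots+(-1)^{n-3}\binom{N}{n-3}x^{N'-n+3}.$$ That is, $F_{K_n}$ has degree $N'$, and for every integer $k$ with $0\le k\le n-3$ the coefficient of $x^{N'-k}$ in $F_{K_n}(x)$ equals $(-1)^k\binom{N}{k}$.
   Context: The flow polynomial $F_G$ of a graph $G=(V,E)$ is the polynomial such that, for every positive integer $q$, $F_G(q)$ is the number of nowhere-zero flows with values in $\mathbb{Z}_q=\mathbb{Z}/q\mathbb{Z}$: after fixing any orientation of the edges, these are the assignments of a nonzero element $k_e\in\mathbb{Z}_q$ to each edge $e$ such that at every vertex the sum of $k_e$ over incoming edges equals the sum over outgoing edges. Equivalently, $F_G$ is the characteristic polynomial $\chi_{M}(x)=\sum_{A\subseteq E}(-1)^{|A|}x^{r_M(E)-r_M(A)}$ of the dual $M=M_G^*$ of the graphic matroid $M_G$ of $G$. -}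

module Defs where

open import Algebra.Properties.Monoid.Sum using (sum-syntax)
open import Data.Bool.Base using (if_then_else_)
open import Data.Fin.Base using (Fin; toℕ)
import Data.Fin.Properties as Fin
open import Data.Integer.Base as ℤ using (ℤ; +_; 0ℤ)
open import Data.List.Base using (List; []; _∷_; [_]; length; lookup; filter; foldr; allFin; cartesianProduct; cartesianProductWith)
open import Data.Nat.Base using (ℕ; zero; suc; _<_; NonZero)
open import Data.Nat.DivMod using (_%_)
open import Data.Nat.Properties using (+-0-monoid; _≟_)
open import Data.Product.Base using (_×_; _,_; proj₁; proj₂; uncurry)
open import Data.Vec.Base as Vec using (Vec)
open import Relation.Binary.PropositionalEquality.Core using (_≡_; _≢_)
open import Relation.Nullary.Decidable using (Dec; does; ¬?; _×-dec_)

-- Finite graphs, loops and parallel edges allowed. An edge (u , v) is oriented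
-- from u to v; this is the fixed reference orientation used to define flows,
-- and the number of flows does not depend on it.
record Graph : Set where
  field
    order : ℕ
    edges : List (Fin order × Fin order)

  size : ℕ
  size = length edges

  tail head : Fin size → Fin order
  tail e = proj₁ (lookup edges e)
  head e = proj₂ (lookup edges e)

K : ℕ → Graph
K n = record
  { order = n
  ; edges = filter (uncurry Fin._<?_) (cartesianProduct (allFin n) (allFin n))
  }

-- Elements of ℤ/qℤ are represented by their residues, i.e. by Fin q; sums are
-- taken in ℕ and compared modulo q.
module _ (G : Graph) (q : ℕ) .{{_ : NonZero q}} where
  open Graph G

  Assignment : Set
  Assignment = Vec (Fin q) size

  inflow outflow : Assignment → Fin order → ℕ
  inflow k v = sum-syntax +-0-monoid size λ e →
    if does (head e Fin.≟ v) then toℕ (Vec.lookup k e) else 0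
  outflow k v = sum-syntax +-0-monoid size λ e →
    if does (tail e Fin.≟ v) then toℕ (Vec.lookup k e) else 0

  IsNowhereZeroFlow : Assignment → Set
  IsNowhereZeroFlow k =
    (∀ e → toℕ (Vec.lookup k e) ≢ 0) ×
    (∀ v → inflow k v % q ≡ outflow k v % q)

  isNowhereZeroFlow? : ∀ k → Dec (IsNowhereZeroFlow k)
  isNowhereZeroFlow? k =
    Fin.all? (λ e → ¬? (toℕ (Vec.lookup k e) ≟ 0)) ×-dec
    Fin.all? (λ v → inflow k v % q ≟ outflow k v % q)

-- Every vector occurs exactly once.
allVectors : ∀ q m → List (Vec (Fin q) m)
allVectors q zero    = [ Vec.[] ]
allVectors q (suc m) = cartesianProductWith Vec._∷_ (allFin q) (allVectors q m)

#nowhereZeroFlows : Graph → (q : ℕ) → .{{NonZero q}} → ℕ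
#nowhereZeroFlows G q =
  length (filter (isNowhereZeroFlow? G q) (allVectors q (Graph.size G)))

-- Integer polynomials as coefficient lists, constant term first; trailing
-- zeros are allowed, so a polynomial is determined only by its coefficients.
Polynomial : Set
Polynomial = List ℤ

coefficient : Polynomial → ℕ → ℤ
coefficient []       _       = 0ℤ
coefficient (a ∷ _)  zero    = a
coefficient (_ ∷ as) (suc i) = coefficient as i

eval : Polynomial → ℤ → ℤ
eval F x = foldr (λ a r → a ℤ.+ x ℤ.* r) 0ℤ F

HasDegree : Polynomial → ℕ → Set
HasDegree F d = coefficient F d ≢ 0ℤ × (∀ i → d < i → coefficient F i ≡ 0ℤ)

IsFlowPolynomial : Graph → Polynomial → Set
IsFlowPolynomial G F =
  ∀ q → .{{_ : NonZero q}} → eval F (+ q) ≡ + #nowhereZeroFlows G q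

{-# OPTIONS --safe #-}
-- Deletion–contraction: a loop multiplies the flow polynomial by x − 1, and any
-- other edge e gives F(G) = F(G/e) − F(G∖e). If every cut of G has at least
-- k + 2 edges, the same is true of G/e, and the cuts of G∖e have at least k + 1
-- edges; moreover G∖e is connected, so its nullity is one less. Hence the
-- coefficient k places below the top is (−1)^k C(|E|, k), by induction on the
-- edges and Pascal's rule. Every cut of K_n has at least n − 1 edges.
module Submission where

open import Defs
open import Data.Bool.Base using (Bool; true; false; if_then_else_)
import Data.Bool.Properties as Bool
open import Data.Fin.Base as Fin using (Fin; toℕ; fromℕ<; punchIn)
import Data.Fin.Properties as Fin
open import Data.Integer.Base as ℤ using (ℤ; +_; 0ℤ; 1ℤ; -1ℤ)
open import Data.Integer.DivMod using (_%ℕ_; _/ℕ_; n%ℕd<d; a≡a%ℕn+[a/ℕn]*n)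
open import Data.Integer.Divisibility.Signed using (divides; _∣?_) renaming (_∣_ to _∣ℤ_)
import Data.Integer.Divisibility.Signed as ∣ℤ
import Data.Integer.Properties as ℤ
open import Data.Integer.Tactic.RingSolver using (solve-∀)
open import Data.List.Base using (List; []; _∷_; _++_; length; filter; map; lookup; allFin; tabulate; cartesianProductWith)
open import Data.List.Membership.Propositional using (_∈_)
open import Data.List.Membership.Propositional.Properties using (∈-filter⁺; ∈-cartesianProduct⁺; ∈-allFin)
open import Data.List.Properties using (length-++; length-tabulate; map-tabulate; filter-++; filter-all; filter-none)
open import Data.List.Relation.Unary.All as All using ()
open import Data.List.Relation.Unary.AllPairs using (_∷_)
open import Data.List.Relation.Unary.Any as Any using (Any; here; there)
open import Data.List.Relation.Unary.Any.Properties using (lookup-index)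
open import Data.List.Relation.Unary.Unique.Propositional using (Unique)
open import Data.List.Relation.Unary.Unique.Propositional.Properties using (allFin⁺)
open import Data.Nat.Base using (ℕ; zero; suc; pred; _+_; _*_; _∸_; _≤_; _<_; z≤n; s≤s; s≤s⁻¹; NonZero)
open import Data.Nat.Combinatorics using (_C_; nCk+nC[k+1]≡[n+1]C[k+1]; k>n⇒nCk≡0)
open import Data.Nat.Divisibility using (_∣_; ∣⇒≤)
open import Data.Nat.DivMod using (_/_; _%_; m≡m%n+[m/n]*n; m%n<n; m*n/n≡m; /-monoˡ-≤)
open import Data.Nat.ListAction using (sum)
open import Data.Nat.Properties
open import Data.Nat.Tactic.RingSolver using () renaming (solve-∀ to ℕ-solve-∀)
open import Data.Product.Base using (_×_; _,_; proj₁; proj₂; ∃-syntax; uncurry)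
open import Data.Sum.Base using (_⊎_; inj₁; inj₂)
open import Data.Vec.Base as Vec using (Vec; []; _∷_)
open import Function.Base using (_∘_; id)
open import Function.Bundles using (_⇔_; mk⇔; Equivalence)
open import Relation.Binary.Definitions using (tri<; tri≈; tri>)
open import Relation.Binary.PropositionalEquality
open import Relation.Nullary using (¬_; Dec; yes; no; does; ¬?; contradiction; _×-dec_)
open import Relation.Nullary.Decidable using (dec-true; dec-false; map′; does-⇔)
open import Relation.Unary using (Decidable)

-- The statement knows `F` only through its values at positive integers, so the recursion has to be
-- matched with actual counts of flows, and coefficients have to be determined by such values.
--
-- Removing vertices at each contraction would change the graph underneath the assignments. Here
-- contraction only coarsens a vertex labelling, so that contracting and deleting an edge leave the
-- same edge list and the same vectors of values. Conservation is stated through potentials constant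
-- on the classes, so a coarser labelling merely restricts the test functions.
--
-- The bound n - 3 is (n - 1) - 2. Cuts of at least two edges make the leading coefficient 1, since
-- a bridge kills all flows; each further deletion costs at most one edge of each cut and uses up
-- one place below the top. Contraction costs nothing, and once a single vertex is left the
-- condition on cuts is vacuous and the polynomial is a power of x - 1, whose coefficients are all
-- signed binomials.

private variable
  A B X V : Set

-- Polynomials

infixl 6 _⊖_

_⊖_ : Polynomial → Polynomial → Polynomial
F       ⊖ []      = F
[]      ⊖ (b ∷ G) = (ℤ.- b) ∷ ([] ⊖ G)
(a ∷ F) ⊖ (b ∷ G) = (a ℤ.- b) ∷ (F ⊖ G)

coefficient-⊖ : ∀ F G i → coefficient (F ⊖ G) i ≡ coefficient F i ℤ.- coefficient G i
coefficient-⊖ F       []      i       = sym (ℤ.+-identityʳ _)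
coefficient-⊖ []      (b ∷ G) zero    = sym (ℤ.+-identityˡ _)
coefficient-⊖ []      (b ∷ G) (suc i) = coefficient-⊖ [] G i
coefficient-⊖ (a ∷ F) (b ∷ G) zero    = refl
coefficient-⊖ (a ∷ F) (b ∷ G) (suc i) = coefficient-⊖ F G i

eval-⊖ : ∀ F G x → eval (F ⊖ G) x ≡ eval F x ℤ.- eval G x
eval-⊖ F       []      x = sym (ℤ.+-identityʳ _)
eval-⊖ []      (b ∷ G) x = trans (cong (λ e → ℤ.- b ℤ.+ x ℤ.* e) (eval-⊖ [] G x)) (lemma b x (eval G x))
  where
  lemma : ∀ b x g → (ℤ.- b) ℤ.+ x ℤ.* (0ℤ ℤ.+ (ℤ.- g)) ≡ 0ℤ ℤ.+ (ℤ.- (b ℤ.+ x ℤ.* g))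
  lemma = solve-∀
eval-⊖ (a ∷ F) (b ∷ G) x =
  trans (cong (λ e → a ℤ.- b ℤ.+ x ℤ.* e) (eval-⊖ F G x)) (lemma a b x (eval F x) (eval G x))
  where
  lemma : ∀ a b x f g → a ℤ.+ (ℤ.- b) ℤ.+ x ℤ.* (f ℤ.+ (ℤ.- g)) ≡ a ℤ.+ x ℤ.* f ℤ.+ (ℤ.- (b ℤ.+ x ℤ.* g))
  lemma = solve-∀

[x-1]_ : Polynomial → Polynomial
[x-1] F = (0ℤ ∷ F) ⊖ F

divisible-by-all⇒0 : ∀ a → (∀ q → .{{NonZero q}} → + q ∣ℤ a) → a ≡ 0ℤ
divisible-by-all⇒0 a div = ℤ.∣i∣≡0⇒i≡0 (n∣m⇒m≡0 ℤ.∣ a ∣ (∣ℤ.∣⇒∣ᵤ (div (suc ℤ.∣ a ∣))))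
  where
  n∣m⇒m≡0 : ∀ m → suc m ∣ m → m ≡ 0
  n∣m⇒m≡0 zero    _ = refl
  n∣m⇒m≡0 (suc m) d = contradiction (∣⇒≤ d) (<⇒≱ (n<1+n (suc m)))

-- No roots are counted. At `q` all terms but the constant one are divisible by `q`, so the constant
-- coefficient is divisible by every positive integer and is 0; cancelling `q` passes to the tail.
vanishing⇒coefficients-0 : ∀ F → (∀ q → .{{NonZero q}} → eval F (+ q) ≡ 0ℤ) →
                           ∀ i → coefficient F i ≡ 0ℤ
vanishing⇒coefficients-0 []      _   _ = refl
vanishing⇒coefficients-0 (a ∷ F) van = λ where
    zero    → a≡0
    (suc i) → vanishing⇒coefficients-0 F tail-van i
  where
  div : ∀ q → .{{NonZero q}} → + q ∣ℤ a
  div q = ∣ℤ.∣m+n∣n⇒∣m {m = a} (subst (+ q ∣ℤ_) (sym (van q)) (divides 0ℤ refl))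
            (∣ℤ.∣m⇒∣m*n (eval F (+ q)) ∣ℤ.∣-refl)
  a≡0 : a ≡ 0ℤ
  a≡0 = divisible-by-all⇒0 a div
  tail-van : ∀ q → .{{NonZero q}} → eval F (+ q) ≡ 0ℤ
  tail-van q@(suc _) = ℤ.*-cancelˡ-≡ (+ q) _ 0ℤ
    (trans (sym (ℤ.+-identityˡ _))
      (trans (cong (ℤ._+ + q ℤ.* eval F (+ q)) (sym a≡0))
        (trans (van q) (sym (ℤ.*-zeroʳ (+ q))))))

coefficients-unique : ∀ F G → (∀ q → .{{_ : NonZero q}} → eval F (+ q) ≡ eval G (+ q)) →
                      ∀ i → coefficient F i ≡ coefficient G i
coefficients-unique F G eq i = ℤ.i-j≡0⇒i≡j _ _ (trans (sym (coefficient-⊖ F G i))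
  (vanishing⇒coefficients-0 (F ⊖ G)
    (λ q → trans (eval-⊖ F G (+ q)) (ℤ.i≡j⇒i-j≡0 (eq q))) i))

-- Contraction

-- A graph is contracted without touching its edges: the vertices of the minor
-- are the classes of a labelling ρ.
Respects : (V → ℕ) → (V → A) → Set
Respects ρ φ = ∀ {x y} → ρ x ≡ ρ y → φ x ≡ φ y

module _ (ρ : V → ℕ) (u v : V) where

  redirect : V → V
  redirect x with ρ x ≟ ρ u
  ... | yes _ = v
  ... | no  _ = x

  merge : V → ℕ
  merge x = ρ (redirect x)

  merge-coarser : Respects ρ merge
  merge-coarser {x} {y} eq with ρ x ≟ ρ u | ρ y ≟ ρ u
  ... | yes _ | yes _ = refl
  ... | no  _ | no  _ = eq
  ... | yes p | no ¬p = contradiction (trans (sym eq) p) ¬p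
  ... | no ¬p | yes p = contradiction (trans eq p) ¬p

  merge-joins : merge u ≡ merge v
  merge-joins with ρ u ≟ ρ u | ρ v ≟ ρ u
  ... | yes _ | yes _ = refl
  ... | yes _ | no  _ = refl
  ... | no ¬p | _     = contradiction refl ¬p

  -- With `merge-coarser` and `merge-joins` this characterises the partition into classes of `merge`
  -- as the finest coarsening that identifies `u` and `v`. The labels depend on the order of merges,
  -- the partition does not, so labellings are compared through this property.
  merge-least : {φ : V → A} → Respects ρ φ → φ u ≡ φ v → Respects merge φ
  merge-least {φ = φ} φ-resp φu≡φv {x} {y} eq =
    trans (φ-redirect x) (trans (φ-resp eq) (sym (φ-redirect y)))
    where
    φ-redirect : ∀ x → φ x ≡ φ (redirect x)
    φ-redirect x with ρ x ≟ ρ u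
    ... | yes p = trans (φ-resp p) φu≡φv
    ... | no  _ = refl

-- If joining `a` and `b` newly identifies `u` and `v`, one of `u`, `v` lies in the class of `a` and
-- the other in that of `b`. This is the exchange property of the graphic matroid.
merge-exchange : ∀ (ρ : V → ℕ) {u v a b} → ρ u ≢ ρ v →
                 merge ρ a b u ≡ merge ρ a b v → merge ρ u v a ≡ merge ρ u v b
merge-exchange ρ {u} {v} {a} {b} u≁v eq with ρ u ≟ ρ a | ρ v ≟ ρ a
... | yes p | yes q = contradiction (trans p (sym q)) u≁v
... | no  _ | no  _ = contradiction eq u≁v
... | yes p | no  _ = trans (merge-coarser ρ u v (sym p))
                        (trans (merge-joins ρ u v) (merge-coarser ρ u v (sym eq)))
... | no  _ | yes q = trans (merge-coarser ρ u v (sym q))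
                        (trans (sym (merge-joins ρ u v)) (merge-coarser ρ u v eq))

-- Nullity and the deletion-contraction polynomial

-- The rank of the dual matroid: an edge counts exactly when the edges before it in the list already
-- connect its ends in the minor. The edges that do not count form a spanning forest.
nullity : (V → ℕ) → List (V × V) → ℕ
nullity ρ []             = 0
nullity ρ ((u , v) ∷ es) with ρ u ≟ ρ v
... | yes _ = suc (nullity ρ es)
... | no  _ = nullity (merge ρ u v) es

-- Bridges need no branch of their own: contracting or deleting a bridge gives the same number of
-- flows, and the difference vanishes as it should.
flowPolynomial : (V → ℕ) → List (V × V) → Polynomial
flowPolynomial ρ []             = 1ℤ ∷ []
flowPolynomial ρ ((u , v) ∷ es) with ρ u ≟ ρ v
... | yes _ = [x-1] flowPolynomial ρ es
... | no  _ = flowPolynomial (merge ρ u v) es ⊖ flowPolynomial ρ es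

nullity-mono : {ρ τ : V → ℕ} → Respects ρ τ → ∀ es → nullity ρ es ≤ nullity τ es
nullity-mono ρ⊑τ [] = z≤n
nullity-mono {ρ = ρ} {τ} ρ⊑τ ((u , v) ∷ es) with ρ u ≟ ρ v | τ u ≟ τ v
... | yes p | yes q = s≤s (nullity-mono ρ⊑τ es)
... | yes p | no ¬q = contradiction (ρ⊑τ p) ¬q
... | no ¬p | yes q = m≤n⇒m≤1+n (nullity-mono (merge-least ρ u v ρ⊑τ q) es)
... | no ¬p | no ¬q =
  nullity-mono (merge-least ρ u v (λ eq → merge-coarser τ u v (ρ⊑τ eq)) (merge-joins τ u v)) es

nullity-cong : {ρ τ : V → ℕ} → Respects ρ τ → Respects τ ρ → ∀ es → nullity ρ es ≡ nullity τ es
nullity-cong ρ⊑τ τ⊑ρ es = ≤-antisym (nullity-mono ρ⊑τ es) (nullity-mono τ⊑ρ es)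

nullity-total : (ρ : V → ℕ) → (∀ x y → ρ x ≡ ρ y) → ∀ es → nullity ρ es ≡ length es
nullity-total ρ tot []             = refl
nullity-total ρ tot ((u , v) ∷ es) with ρ u ≟ ρ v
... | yes _ = cong suc (nullity-total ρ tot es)
... | no ¬p = contradiction (tot u v) ¬p

coefficient-[x-1] : ∀ F i → coefficient ([x-1] F) (suc i) ≡ coefficient F i ℤ.- coefficient F (suc i)
coefficient-[x-1] F i = coefficient-⊖ (0ℤ ∷ F) F (suc i)

degree≤nullity : ∀ (ρ : V → ℕ) es i → nullity ρ es < i → coefficient (flowPolynomial ρ es) i ≡ 0ℤ
degree≤nullity ρ []             (suc i) _  = refl
degree≤nullity ρ ((u , v) ∷ es) i       lt with ρ u ≟ ρ v
degree≤nullity ρ ((u , v) ∷ es) (suc i) (s≤s lt) | yes _ =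
  trans (coefficient-[x-1] (flowPolynomial ρ es) i)
    (cong₂ ℤ._-_ (degree≤nullity ρ es i lt) (degree≤nullity ρ es (suc i) (m≤n⇒m≤1+n lt)))
degree≤nullity ρ ((u , v) ∷ es) i lt | no _ =
  trans (coefficient-⊖ (flowPolynomial (merge ρ u v) es) (flowPolynomial ρ es) i)
    (cong₂ ℤ._-_ (degree≤nullity (merge ρ u v) es i lt)
      (degree≤nullity ρ es i (≤-<-trans (nullity-mono (merge-coarser ρ u v) es) lt)))

-- Edge connectivity

crossing : (V → Bool) → List (V × V) → ℕ
crossing σ es = length (filter (λ e → ¬? (σ (proj₁ e) Bool.≟ σ (proj₂ e))) es)

-- Cuts of the minor are the two-colourings constant on the classes of `ρ` that take both values.
-- With a single class there are none and the condition holds for every `j`, so the induction can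
-- contract down to one vertex.
EdgeConnected : ℕ → (V → ℕ) → List (V × V) → Set
EdgeConnected j ρ es = ∀ σ → Respects ρ σ → ∀ {x y} → σ x ≢ σ y → j ≤ crossing σ es

crossing-loop : ∀ (σ : V → Bool) e es → σ (proj₁ e) ≡ σ (proj₂ e) → crossing σ (e ∷ es) ≡ crossing σ es
crossing-loop σ (u , v) es eq with σ u Bool.≟ σ v
... | yes _ = refl
... | no ¬p = contradiction eq ¬p

crossing-∷ : ∀ (σ : V → Bool) e es → crossing σ (e ∷ es) ≤ suc (crossing σ es)
crossing-∷ σ (u , v) es with σ u Bool.≟ σ v
... | yes _ = n≤1+n _
... | no  _ = ≤-refl

crossing≤length : ∀ (σ : V → Bool) es → crossing σ es ≤ length es
crossing≤length σ []       = z≤n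
crossing≤length σ (e ∷ es) = ≤-trans (crossing-∷ σ e es) (s≤s (crossing≤length σ es))

EdgeConnected-coarser : ∀ {ρ : V → ℕ} {es j} {τ : V → ℕ} → Respects ρ τ → EdgeConnected j ρ es → EdgeConnected j τ es
EdgeConnected-coarser ρ⊑τ conn σ σ-resp = conn σ (λ eq → σ-resp (ρ⊑τ eq))

EdgeConnected-weaken : ∀ {ρ : V → ℕ} {es i j} → i ≤ j → EdgeConnected j ρ es → EdgeConnected i ρ es
EdgeConnected-weaken i≤j conn σ σ-resp x≢y = ≤-trans i≤j (conn σ σ-resp x≢y)

EdgeConnected-loop : ∀ {ρ : V → ℕ} {e es j} → ρ (proj₁ e) ≡ ρ (proj₂ e) → EdgeConnected j ρ (e ∷ es) → EdgeConnected j ρ es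
EdgeConnected-loop {e = e} {es = es} loop conn σ σ-resp x≢y =
  subst (_ ≤_) (crossing-loop σ e es (σ-resp loop)) (conn σ σ-resp x≢y)

EdgeConnected-contract : ∀ {ρ : V → ℕ} {es j u v} → EdgeConnected j ρ ((u , v) ∷ es) → EdgeConnected j (merge ρ u v) es
EdgeConnected-contract {ρ = ρ} {es = es} {u = u} {v = v} conn =
  EdgeConnected-loop {ρ = merge ρ u v} {es = es} (merge-joins ρ u v)
    (EdgeConnected-coarser {ρ = ρ} {es = (u , v) ∷ es} (merge-coarser ρ u v) conn)

EdgeConnected-delete : ∀ {ρ : V → ℕ} {e es j} → EdgeConnected (suc j) ρ (e ∷ es) → EdgeConnected j ρ es
EdgeConnected-delete {e = e} {es = es} conn σ σ-resp x≢y =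
  s≤s⁻¹ (≤-trans (conn σ σ-resp x≢y) (crossing-∷ σ e es))

-- Edge connectivity and nullity

EdgeConnected⇒≤length : ∀ {ρ : V → ℕ} {es j u v} → ρ u ≢ ρ v → EdgeConnected j ρ es → j ≤ length es
EdgeConnected⇒≤length {ρ = ρ} {es = es} {u = u} {v = v} u≁v conn =
  ≤-trans (conn (λ x → does (ρ x ≟ ρ u)) (cong (λ c → does (c ≟ ρ u))) {u} {v} separated)
          (crossing≤length _ es)
  where
  separated : does (ρ u ≟ ρ u) ≢ does (ρ v ≟ ρ u)
  separated rewrite dec-true (ρ u ≟ ρ u) refl | dec-false (ρ v ≟ ρ u) (≢-sym u≁v) = λ ()

-- A path between `u` and `v` closes into a cycle when they are identified. Along the list exactly
-- one edge turns from a forest edge into a loop, and after it both labellings have the same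
-- classes.
nullity-merge : ∀ (ρ : V → ℕ) es u v → EdgeConnected 1 ρ es → ρ u ≢ ρ v →
                nullity (merge ρ u v) es ≡ suc (nullity ρ es)
nullity-merge ρ [] u v conn u≁v with () ← EdgeConnected⇒≤length {ρ = ρ} {es = []} u≁v conn
nullity-merge ρ ((a , b) ∷ es) u v conn u≁v with ρ a ≟ ρ b | merge ρ u v a ≟ merge ρ u v b
... | yes p | yes _ = cong suc (nullity-merge ρ es u v (EdgeConnected-loop {ρ = ρ} {es = es} p conn) u≁v)
... | yes p | no ¬q = contradiction (merge-coarser ρ u v p) ¬q
-- This is the edge that becomes a loop: by exchange, joining its ends or joining `u` and `v` gives
-- the same partition.
... | no ¬p | yes q = cong suc (nullity-cong
        (merge-least ρ u v (merge-coarser ρ a b) (merge-exchange ρ ¬p q))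
        (merge-least ρ a b (merge-coarser ρ u v) q) es)
-- The two identifications commute as partitions, and by exchange `u` and `v` stay apart when the
-- edge is contracted.
... | no ¬p | no ¬q = trans
        (nullity-cong
          (merge-least ρuv a b
            (merge-least ρ u v (λ eq → merge-coarser ρab u v (merge-coarser ρ a b eq)) (merge-joins ρab u v))
            (merge-coarser ρab u v (merge-joins ρ a b)))
          (merge-least ρab u v
            (merge-least ρ a b (λ eq → merge-coarser ρuv a b (merge-coarser ρ u v eq)) (merge-joins ρuv a b))
            (merge-coarser ρuv a b (merge-joins ρ u v)))
          es)
        (nullity-merge ρab es u v (EdgeConnected-contract {ρ = ρ} {es = es} conn)
          (λ eq → ¬q (merge-exchange ρ u≁v eq)))
  where
  ρuv = merge ρ u v
  ρab = merge ρ a b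

-- Before the last contraction of a non-loop there is still a cut, hence at least `suc j` edges;
-- after it at least `j` of them remain, all loops. If nothing is ever contracted, every edge is a
-- loop from the start.
nullity-large : ∀ (ρ : V → ℕ) es j → EdgeConnected (suc j) ρ es →
                j ≤ nullity ρ es ⊎ nullity ρ es ≡ length es
nullity-large ρ [] j conn = inj₂ refl
nullity-large ρ ((u , v) ∷ es) j conn with ρ u ≟ ρ v
... | yes p with nullity-large ρ es j (EdgeConnected-loop {ρ = ρ} {es = es} p conn)
...   | inj₁ le = inj₁ (m≤n⇒m≤1+n le)
...   | inj₂ eq = inj₂ (cong suc eq)
nullity-large ρ ((u , v) ∷ es) j conn | no ¬p
  with nullity-large (merge ρ u v) es j (EdgeConnected-contract {ρ = ρ} {es = es} conn)
...   | inj₁ le = inj₁ le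
...   | inj₂ eq = inj₁ (subst (j ≤_) (sym eq)
                    (s≤s⁻¹ (EdgeConnected⇒≤length {ρ = ρ} {es = (u , v) ∷ es} ¬p conn)))

-- The top coefficients

signedBinomial : ℕ → ℕ → ℤ
signedBinomial m k = (-1ℤ ℤ.^ k) ℤ.* (+ (m C k))

signedBinomial-Pascal : ∀ m k →
  signedBinomial (suc m) (suc k) ≡ signedBinomial m (suc k) ℤ.- signedBinomial m k
signedBinomial-Pascal m k = trans
  (cong (λ c → (-1ℤ ℤ.^ suc k) ℤ.* c)
    (trans (cong +_ (sym (nCk+nC[k+1]≡[n+1]C[k+1] m k))) (ℤ.pos-+ (m C k) (m C suc k))))
  (lemma (-1ℤ ℤ.^ k) (+ (m C k)) (+ (m C suc k)))
  where
  lemma : ∀ s a b → (-1ℤ ℤ.* s) ℤ.* (a ℤ.+ b) ≡ (-1ℤ ℤ.* s) ℤ.* b ℤ.+ (ℤ.- (s ℤ.* a))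
  lemma = solve-∀

signedBinomial-> : ∀ {m k} → m < k → signedBinomial m k ≡ 0ℤ
signedBinomial-> {m} {k} m<k = trans (cong (λ c → (-1ℤ ℤ.^ k) ℤ.* (+ c)) (k>n⇒nCk≡0 m<k)) (ℤ.*-zeroʳ (-1ℤ ℤ.^ k))

-- The position is given by `j + i` equal to the nullity, which avoids truncated subtraction. Loops
-- and contractions keep `k`; only the deleted graph needs the statement for a smaller `k`, and
-- there `i` drops as well.
top-coefficient : ∀ (ρ : V → ℕ) es k → EdgeConnected (2 + k) ρ es →
                  ∀ i j → i ≤ k → j + i ≡ nullity ρ es →
                  coefficient (flowPolynomial ρ es) j ≡ signedBinomial (length es) i
top-coefficient ρ [] k conn zero zero i≤k eq = refl
top-coefficient ρ ((u , v) ∷ es) k conn i j i≤k eq with ρ u ≟ ρ v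
-- The constant term of (x - 1)P receives nothing from xP, so the Pascal term
-- `signedBinomial m (suc i)` has to vanish. Here `i` is the nullity of `es` and is less than `k`,
-- so `nullity-large` leaves only loops, and `m` equals `i`.
top-coefficient ρ ((u , v) ∷ es) k conn (suc i) zero i<k refl | yes p = begin
  coefficient ([x-1] P) 0      ≡⟨ coefficient-⊖ (0ℤ ∷ P) P 0 ⟩
  0ℤ ℤ.- coefficient P 0       ≡⟨ cong₂ ℤ._-_ (sym (signedBinomial-> m<1+ν))
                                    (top-coefficient ρ es k conn′ i 0 (<⇒≤ i<k) refl) ⟩
  signedBinomial m (suc i) ℤ.- signedBinomial m i ≡⟨ signedBinomial-Pascal m i ⟨
  signedBinomial (suc m) (suc i) ∎
  where
  open ≡-Reasoning
  P = flowPolynomial ρ es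
  m = length es
  conn′ = EdgeConnected-loop {ρ = ρ} {es = es} p conn
  m<1+ν : m < suc (nullity ρ es)
  m<1+ν with nullity-large ρ es (suc k) conn′
  ... | inj₁ k<ν = contradiction (≤-trans k<ν (<⇒≤ i<k)) 1+n≰n
  ... | inj₂ ν≡m = s≤s (≤-reflexive (sym ν≡m))
top-coefficient ρ ((u , v) ∷ es) k conn i (suc j) i≤k eq | yes p = begin
  coefficient ([x-1] P) (suc j)               ≡⟨ coefficient-[x-1] P j ⟩
  coefficient P j ℤ.- coefficient P (suc j)   ≡⟨ cong₂ ℤ._-_ (top-coefficient ρ es k conn′ i j i≤k (suc-injective eq)) refl ⟩
  signedBinomial m i ℤ.- coefficient P (suc j) ≡⟨ lower i i≤k (suc-injective eq) ⟩
  signedBinomial (suc m) i ∎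
  where
  open ≡-Reasoning
  P = flowPolynomial ρ es
  m = length es
  conn′ = EdgeConnected-loop {ρ = ρ} {es = es} p conn
  lower : ∀ i → i ≤ k → j + i ≡ nullity ρ es →
          signedBinomial m i ℤ.- coefficient P (suc j) ≡ signedBinomial (suc m) i
  lower zero    _   eq = cong (λ c → 1ℤ ℤ.- c)
    (degree≤nullity ρ es (suc j) (s≤s (≤-reflexive (trans (sym eq) (+-identityʳ j)))))
  lower (suc i) i<k eq = trans
    (cong (λ c → signedBinomial m (suc i) ℤ.- c)
      (top-coefficient ρ es k conn′ i (suc j) (<⇒≤ i<k) (trans (sym (+-suc j i)) eq)))
    (sym (signedBinomial-Pascal m i))
top-coefficient ρ ((u , v) ∷ es) k conn i j i≤k eq | no ¬p = begin
  coefficient (P/e ⊖ P∖e) j                  ≡⟨ coefficient-⊖ P/e P∖e j ⟩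
  coefficient P/e j ℤ.- coefficient P∖e j    ≡⟨ cong₂ ℤ._-_ (top-coefficient (merge ρ u v) es k
                                                (EdgeConnected-contract {ρ = ρ} {es = es} conn) i j i≤k eq) refl ⟩
  signedBinomial m i ℤ.- coefficient P∖e j   ≡⟨ deleted i k i≤k (EdgeConnected-delete {ρ = ρ} {es = es} conn)
                                                  (trans eq ν/e≡1+ν∖e) ⟩
  signedBinomial (suc m) i ∎
  where
  open ≡-Reasoning
  P/e = flowPolynomial (merge ρ u v) es
  P∖e = flowPolynomial ρ es
  m = length es
  ν/e≡1+ν∖e : nullity (merge ρ u v) es ≡ suc (nullity ρ es)
  ν/e≡1+ν∖e = nullity-merge ρ es u v
    (EdgeConnected-weaken {ρ = ρ} {es = es} (s≤s z≤n) (EdgeConnected-delete {ρ = ρ} {es = es} conn)) ¬p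
  -- Deletion lowers the nullity by one, so x^j is only `i − 1` places below the top of the deleted
  -- polynomial, and its cuts of `suc k` edges suffice for `k − 1`. For `i = 0` the power `j`
  -- exceeds its degree.
  deleted : ∀ i k → i ≤ k → EdgeConnected (suc k) ρ es → j + i ≡ suc (nullity ρ es) →
            signedBinomial m i ℤ.- coefficient P∖e j ≡ signedBinomial (suc m) i
  deleted zero    _       _         _     eq = cong (λ c → 1ℤ ℤ.- c)
    (degree≤nullity ρ es j (≤-reflexive (trans (sym eq) (+-identityʳ j))))
  deleted (suc i) (suc k) (s≤s i≤k) conn′ eq = trans
    (cong (λ c → signedBinomial m (suc i) ℤ.- c)
      (top-coefficient ρ es k conn′ i j i≤k (suc-injective (trans (sym (+-suc j i)) eq))))
    (sym (signedBinomial-Pascal m i))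

-- Counting with decidable predicates

count : {P : A → Set} → Decidable P → List A → ℕ
count P? xs = length (filter P? xs)

indicator : {P : Set} → Dec P → ℕ
indicator d = if does d then 1 else 0

module _ {P : A → Set} (P? : Decidable P) where

  count-∷ : ∀ x xs → count P? (x ∷ xs) ≡ indicator (P? x) + count P? xs
  count-∷ x xs with does (P? x)
  ... | true  = refl
  ... | false = refl

  count-++ : ∀ xs ys → count P? (xs ++ ys) ≡ count P? xs + count P? ys
  count-++ xs ys = trans (cong length (filter-++ P? xs ys)) (length-++ (filter P? xs))

  count-map : (f : B → A) → ∀ xs → count P? (map f xs) ≡ count (P? ∘ f) xs
  count-map f []       = refl
  count-map f (x ∷ xs) with does (P? (f x))
  ... | true  = cong suc (count-map f xs)
  ... | false = count-map f xs

  count-cong : {Q : A → Set} (Q? : Decidable Q) → (∀ x → does (P? x) ≡ does (Q? x)) →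
               ∀ xs → count P? xs ≡ count Q? xs
  count-cong Q? eq []       = refl
  count-cong Q? eq (x ∷ xs) with does (P? x) | does (Q? x) | eq x
  ... | true  | .true  | refl = cong suc (count-cong Q? eq xs)
  ... | false | .false | refl = count-cong Q? eq xs

  -- The product lists pairs by first component, while the counts below need fibres over the second:
  -- the tails of a given head, or the values of the first edge when all others are fixed.
  count-cartesianProductWith : ∀ (f : B → X → A) xs ys →
    count P? (cartesianProductWith f xs ys) ≡ sum (map (λ y → count (λ x → P? (f x y)) xs) ys)
  count-cartesianProductWith f []       ys = sym (sum-0 ys)
    where
    sum-0 : ∀ ys → sum (map (λ _ → 0) ys) ≡ 0
    sum-0 []       = refl
    sum-0 (_ ∷ ys) = sum-0 ys
  count-cartesianProductWith f (x ∷ xs) ys = begin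
    count P? (map (f x) ys ++ cartesianProductWith f xs ys)
      ≡⟨ count-++ (map (f x) ys) _ ⟩
    count P? (map (f x) ys) + count P? (cartesianProductWith f xs ys)
      ≡⟨ cong (λ s → count P? (map (f x) ys) + s) (count-cartesianProductWith f xs ys) ⟩
    count P? (map (f x) ys) + sum (map (λ y → count (λ x → P? (f x y)) xs) ys)
      ≡⟨ split ys ⟩
    sum (map (λ y → count (λ x → P? (f x y)) (x ∷ xs)) ys) ∎
    where
    open ≡-Reasoning
    split : ∀ ys → count P? (map (f x) ys) + sum (map (λ y → count (λ x → P? (f x y)) xs) ys) ≡
                   sum (map (λ y → count (λ x → P? (f x y)) (x ∷ xs)) ys)
    split []       = refl
    split (y ∷ ys) = begin
      count P? (f x y ∷ map (f x) ys) + (c + s)        ≡⟨ cong (_+ (c + s)) (count-∷ (f x y) (map (f x) ys)) ⟩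
      (i + count P? (map (f x) ys)) + (c + s)          ≡⟨ swap i _ c s ⟩
      (i + c) + (count P? (map (f x) ys) + s)          ≡⟨ cong₂ _+_ (sym (count-∷ʳ y)) (split ys) ⟩
      count (λ x → P? (f x y)) (x ∷ xs) + sum (map (λ y → count (λ x → P? (f x y)) (x ∷ xs)) ys) ∎
      where
      i = indicator (P? (f x y))
      c = count (λ x → P? (f x y)) xs
      s = sum (map (λ y → count (λ x → P? (f x y)) xs) ys)
      swap : ∀ a b c d → (a + b) + (c + d) ≡ (a + c) + (b + d)
      swap = ℕ-solve-∀
      count-∷ʳ : ∀ y → count (λ x → P? (f x y)) (x ∷ xs) ≡ indicator (P? (f x y)) + count (λ x → P? (f x y)) xs
      count-∷ʳ y with does (P? (f x y))
      ... | true  = refl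
      ... | false = refl

sum-map-+ : ∀ (f g : A → ℕ) xs → sum (map (λ x → f x + g x) xs) ≡ sum (map f xs) + sum (map g xs)
sum-map-+ f g []       = refl
sum-map-+ f g (x ∷ xs) = trans (cong (λ s → f x + g x + s) (sum-map-+ f g xs)) (swap (f x) (g x) _ _)
  where
  swap : ∀ a b c d → (a + b) + (c + d) ≡ (a + c) + (b + d)
  swap = ℕ-solve-∀

sum-map-cong : {f g : A → ℕ} → (∀ x → f x ≡ g x) → ∀ xs → sum (map f xs) ≡ sum (map g xs)
sum-map-cong eq []       = refl
sum-map-cong eq (x ∷ xs) = cong₂ _+_ (eq x) (sum-map-cong eq xs)

indicator-cases : {P : Set} (P? : Dec P) {c n : ℕ} → (P → n ≡ c) → (¬ P → n ≡ 0) → n ≡ c * indicator P?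
indicator-cases (yes x) {c} n≡c _   = trans (n≡c x) (sym (*-identityʳ c))
indicator-cases (no ¬x) {c} _   n≡0 = trans (n≡0 ¬x) (sym (*-zeroʳ c))

module _ {P : A → Set} (P? : Decidable P) where

  sum-indicator : ∀ c xs → sum (map (λ x → c * indicator (P? x)) xs) ≡ c * count P? xs
  sum-indicator c []       = sym (*-zeroʳ c)
  sum-indicator c (x ∷ xs) = trans (cong (λ s → c * indicator (P? x) + s) (sum-indicator c xs))
    (trans (sym (*-distribˡ-+ c (indicator (P? x)) (count P? xs)))
      (cong (c *_) (sym (count-∷ P? x xs))))

  count-all : (∀ x → P x) → ∀ xs → count P? xs ≡ length xs
  count-all all xs = cong length (filter-all P? (All.universal all xs))

  count-none : (∀ x → ¬ P x) → ∀ xs → count P? xs ≡ 0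
  count-none none xs = cong length (filter-none P? (All.universal none xs))

  count-unique : ∀ {x xs} → Unique xs → x ∈ xs → P x → (∀ {y} → P y → y ≡ x) → count P? xs ≡ 1
  count-unique {x} {.x ∷ xs} (x≢ ∷ _) (here refl) px only = trans (count-∷ P? x xs)
    (cong₂ _+_ (cong (λ b → if b then 1 else 0) (dec-true (P? x) px))
      (cong length (filter-none P? (All.map (λ x≢y py → x≢y (sym (only py))) x≢))))
  count-unique {x} {y ∷ xs} (y≢ ∷ uniq) (there x∈) px only = trans (count-∷ P? y xs)
    (cong₂ _+_ (cong (λ b → if b then 1 else 0) (dec-false (P? y) (λ py → All.lookup y≢ x∈ (only py))))
      (count-unique uniq x∈ px only))

-- The complete graph

KEdges : ∀ n → List (Fin n × Fin n)
KEdges n = Graph.edges (K n)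

-- Edges are grouped by their larger end. After all vertices are shifted up by one, each of the `n`
-- nonzero vertices gains the smaller neighbour `zero`.
size-suc : ∀ n → length (KEdges (suc n)) ≡ n + length (KEdges n)
size-suc n = begin
  length (KEdges (suc n))
    ≡⟨ count-cartesianProductWith (uncurry Fin._<?_) _,_ (allFin (suc n)) (allFin (suc n)) ⟩
  count (Fin._<? Fin.zero {n}) (allFin (suc n)) + sum (map (below (suc n)) (tabulate Fin.suc))
    ≡⟨ cong₂ _+_ (cong length (filter-none (Fin._<? Fin.zero {n}) (All.universal (λ _ ()) (allFin (suc n)))))
                 (cong (sum ∘ map (below (suc n))) (sym (map-tabulate id Fin.suc))) ⟩
  sum (map (below (suc n)) (map Fin.suc (allFin n)))
    ≡⟨ columns (allFin n) ⟩
  length (allFin n) + sum (map (below n) (allFin n))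
    ≡⟨ cong₂ _+_ (length-tabulate id) (sym (count-cartesianProductWith (uncurry Fin._<?_) _,_ (allFin n) (allFin n))) ⟩
  n + length (KEdges n) ∎
  where
  open ≡-Reasoning
  below : ∀ n → Fin n → ℕ
  below n j = count (λ i → i Fin.<? j) (allFin n)
  below-suc : ∀ j → below (suc n) (Fin.suc j) ≡ suc (below n j)
  below-suc j = cong suc (begin
    count <suc-j? (tabulate Fin.suc)                    ≡⟨ cong (count <suc-j?) (sym (map-tabulate id Fin.suc)) ⟩
    count <suc-j? (map Fin.suc (allFin n))              ≡⟨ count-map <suc-j? Fin.suc (allFin n) ⟩
    count (λ i → Fin.suc i Fin.<? Fin.suc j) (allFin n)      ≡⟨ count-cong (<suc-j? ∘ Fin.suc) (Fin._<? j) (λ _ → refl) (allFin n) ⟩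
    below n j ∎)
    where
    <suc-j? : (i : Fin (suc n)) → Dec (i Fin.< Fin.suc j)
    <suc-j? i = i Fin.<? Fin.suc j
  columns : ∀ js → sum (map (below (suc n)) (map Fin.suc js)) ≡ length js + sum (map (below n) js)
  columns []       = refl
  columns (j ∷ js) = trans (cong₂ _+_ (below-suc j) (columns js)) (swap (below n j) (length js) _)
    where
    swap : ∀ a b c → suc a + (b + c) ≡ suc b + (a + c)
    swap = ℕ-solve-∀

size-K : ∀ n → n * (n ∸ 1) / 2 ≡ length (KEdges n)
size-K n = trans (cong (_/ 2) (sym (size*2 n))) (m*n/n≡m (length (KEdges n)) 2)
  where
  size*2 : ∀ n → length (KEdges n) * 2 ≡ n * (n ∸ 1)
  size*2 zero          = refl
  size*2 (suc zero)    = refl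
  size*2 (suc (suc n)) = trans (cong (_* 2) (size-suc (suc n)))
    (trans (*-distribʳ-+ 2 (suc n) (length (KEdges (suc n)))) (trans (cong (λ s → suc n * 2 + s) (size*2 (suc n))) (lemma n)))
    where
    lemma : ∀ n → suc n * 2 + suc n * n ≡ suc (suc n) * suc n
    lemma = ℕ-solve-∀

∈-KEdges : ∀ {n} {x y : Fin n} → x Fin.< y → (x , y) ∈ KEdges n
∈-KEdges x<y = ∈-filter⁺ (uncurry Fin._<?_) (∈-cartesianProduct⁺ (∈-allFin _) (∈-allFin _)) x<y

-- For a cut separating x from y, each vertex z ≠ y is joined across the cut to
-- y or to x, and these edges are distinct.
K-edgeConnected : ∀ m → EdgeConnected m toℕ (KEdges (suc m))
K-edgeConnected m σ _ {x} {y} σx≢σy = Fin.injective⇒≤ {f = index ∘ punchIn y} λ {i} {j} eq →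
  Fin.punchIn-injective y i j (index-injective (Fin.punchInᵢ≢i y i) (Fin.punchInᵢ≢i y j) eq)
  where
  cut = filter (λ e → ¬? (σ (proj₁ e) Bool.≟ σ (proj₂ e))) (KEdges (suc m))

  opposite : Fin (suc m) → Fin (suc m)
  opposite z with σ z Bool.≟ σ x
  ... | yes _ = y
  ... | no  _ = x

  opposite-x : ∀ z → opposite z ≢ y → opposite z ≡ x
  opposite-x z ≢y with σ z Bool.≟ σ x
  ... | yes _ = contradiction refl ≢y
  ... | no  _ = refl

  opposite-crosses : ∀ z → σ z ≢ σ (opposite z)
  opposite-crosses z with σ z Bool.≟ σ x
  ... | yes p = λ eq → σx≢σy (trans (sym p) eq)
  ... | no ¬p = ¬p

  Joins : Fin (suc m) → Fin (suc m) × Fin (suc m) → Set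
  Joins z e = e ≡ (z , opposite z) ⊎ e ≡ (opposite z , z)

  joining : ∀ z → Any (Joins z) cut
  joining z with Fin.<-cmp z (opposite z)
  ... | tri< z<o _ _ = Any.map (λ eq → inj₁ (sym eq))
          (∈-filter⁺ _ (∈-KEdges z<o) (opposite-crosses z))
  ... | tri≈ _ z≡o _ = contradiction (cong σ z≡o) (opposite-crosses z)
  ... | tri> _ _ o<z = Any.map (λ eq → inj₂ (sym eq))
          (∈-filter⁺ _ (∈-KEdges o<z) (≢-sym (opposite-crosses z)))

  index : Fin (suc m) → Fin (length cut)
  index z = Any.index (joining z)

  -- Two vertices other than `y` that were opposite to each other would both equal `x`, and an edge
  -- of the cut has distinct ends. Leaving out `y` is essential: `x` and `y` are opposite to each
  -- other and share an edge.
  not-opposite : ∀ {z w} → z ≢ y → w ≢ y → z ≡ opposite w → w ≢ opposite z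
  not-opposite {z} {w} z≢y w≢y z≡ow w≡oz =
    opposite-crosses z (cong σ (trans z≡x (sym (opposite-x z oz≢y))))
    where
    oz≢y : opposite z ≢ y
    oz≢y eq = w≢y (trans w≡oz eq)
    z≡x : z ≡ x
    z≡x = trans z≡ow (opposite-x w (λ eq → z≢y (trans z≡ow eq)))

  index-injective : ∀ {z w} → z ≢ y → w ≢ y → index z ≡ index w → z ≡ w
  index-injective {z} {w} z≢y w≢y eq
    with lookup-index (joining z) | subst (Joins w ∘ lookup cut) (sym eq) (lookup-index (joining w))
  ... | inj₁ p | inj₁ q = cong proj₁ (trans (sym p) q)
  ... | inj₂ p | inj₂ q = cong proj₂ (trans (sym p) q)
  ... | inj₁ p | inj₂ q = contradiction (sym (cong proj₂ (trans (sym p) q)))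
                            (not-opposite z≢y w≢y (cong proj₁ (trans (sym p) q)))
  ... | inj₂ p | inj₁ q = contradiction (sym (cong proj₁ (trans (sym p) q)))
                            (not-opposite z≢y w≢y (cong proj₂ (trans (sym p) q)))

-- The first t + 1 vertices are contracted to one.
collapse : ∀ {n} → ℕ → Fin n → ℕ
collapse t x = toℕ x ∸ t

-- Vertices `t` and `suc t` have labels 0 and 1 under `collapse t`. Merging them gives the partition
-- of `collapse (suc t)`, though not the same labels.
nullity-collapse-suc : ∀ {n} t → suc t < n → (es : List (Fin n × Fin n)) → EdgeConnected 1 toℕ es →
                       nullity (collapse (suc t)) es ≡ suc (nullity (collapse t) es)
nullity-collapse-suc {n} t 1+t<n es conn = trans
  (nullity-cong coarser (merge-least ρ u v finer (trans u-collapsed (sym v-collapsed))) es)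
  (nullity-merge ρ es u v (EdgeConnected-coarser {ρ = toℕ} {es = es} (cong (_∸ t)) conn) ρu≢ρv)
  where
  ρ = collapse {n} t
  u = fromℕ< (<⇒≤ 1+t<n)
  v = fromℕ< 1+t<n
  u≡t : toℕ u ≡ t
  u≡t = Fin.toℕ-fromℕ< (<⇒≤ 1+t<n)
  v≡1+t : toℕ v ≡ suc t
  v≡1+t = Fin.toℕ-fromℕ< 1+t<n
  ρu≡0 : ρ u ≡ 0
  ρu≡0 = trans (cong (_∸ t) u≡t) (n∸n≡0 t)
  ρv≡1 : ρ v ≡ 1
  ρv≡1 = trans (cong (_∸ t) v≡1+t) (m+n∸n≡m 1 t)
  ρu≢ρv : ρ u ≢ ρ v
  ρu≢ρv eq with () ← trans (sym ρu≡0) (trans eq ρv≡1)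
  u-collapsed : collapse (suc t) u ≡ 0
  u-collapsed = trans (cong (_∸ suc t) u≡t) (m≤n⇒m∸n≡0 (n≤1+n t))
  v-collapsed : collapse (suc t) v ≡ 0
  v-collapsed = trans (cong (_∸ suc t) v≡1+t) (n∸n≡0 (suc t))
  pred-collapse : ∀ x → pred (ρ x) ≡ collapse (suc t) x
  pred-collapse x = pred[m∸n]≡m∸[1+n] (toℕ x) t
  finer : Respects ρ (collapse (suc t))
  finer {x} {y} eq = trans (sym (pred-collapse x)) (trans (cong pred eq) (pred-collapse y))
  -- One more collapse is `pred` on labels, and truncation at 0 makes it identify 0 with 1 and
  -- nothing else.
  pred-cases : ∀ a b → pred a ≡ pred b → a ≡ b ⊎ (a ≡ 0 × b ≡ 1) ⊎ (a ≡ 1 × b ≡ 0)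
  pred-cases zero    zero           _    = inj₁ refl
  pred-cases zero    (suc .zero)    refl = inj₂ (inj₁ (refl , refl))
  pred-cases (suc a) zero           refl = inj₂ (inj₂ (refl , refl))
  pred-cases (suc a) (suc .a)       refl = inj₁ refl
  coarser : Respects (collapse (suc t)) (merge ρ u v)
  coarser {x} {y} eq with pred-cases (ρ x) (ρ y) (trans (pred-collapse x) (trans eq (sym (pred-collapse y))))
  ... | inj₁ p              = merge-coarser ρ u v p
  ... | inj₂ (inj₁ (p , q)) = trans (merge-coarser ρ u v (trans p (sym ρu≡0)))
          (trans (merge-joins ρ u v) (merge-coarser ρ u v (trans ρv≡1 (sym q))))
  ... | inj₂ (inj₂ (p , q)) = trans (merge-coarser ρ u v (trans p (sym ρv≡1)))
          (trans (sym (merge-joins ρ u v)) (merge-coarser ρ u v (trans ρu≡0 (sym q))))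

nullity-collapse : ∀ {n} t → t < n → (es : List (Fin n × Fin n)) → EdgeConnected 1 toℕ es →
                   nullity (collapse t) es ≡ t + nullity toℕ es
nullity-collapse zero    _   es _    = refl
nullity-collapse (suc t) t<n es conn =
  trans (nullity-collapse-suc t t<n es conn) (cong suc (nullity-collapse t (<⇒≤ t<n) es conn))

-- Euler's relation for a connected graph on `suc m` vertices: each of `m` identifications raises
-- the nullity by one, and at the end every edge is a loop.
nullity-connected : ∀ m (es : List (Fin (suc m) × Fin (suc m))) → EdgeConnected 1 toℕ es →
                    length es ≡ m + nullity toℕ es
nullity-connected m es conn = trans
  (sym (nullity-total (collapse m) (λ x y → trans (collapsed x) (sym (collapsed y))) es))
  (nullity-collapse m ≤-refl es conn)
  where
  collapsed : (x : Fin (suc m)) → collapse m x ≡ 0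
  collapsed x = m≤n⇒m∸n≡0 (s≤s⁻¹ (Fin.toℕ<n x))

nullity-K : ∀ n → 2 ≤ n → (n ∸ 1) * (n ∸ 2) / 2 ≡ nullity toℕ (KEdges n)
nullity-K (suc zero)    (s≤s ())
-- The number (n - 1)(n - 2)/2 is the size of the complete graph on one vertex less, and `size-suc`
-- and Euler's relation subtract the same n - 1 from the size of K_n.
nullity-K (suc (suc m)) _ = trans (size-K (suc m)) (+-cancelˡ-≡ (suc m) _ _
  (trans (sym (size-suc (suc m)))
    (nullity-connected (suc m) (KEdges (suc (suc m)))
      (EdgeConnected-weaken {ρ = toℕ} {es = KEdges (suc (suc m))} (s≤s z≤n) (K-edgeConnected (suc m))))))

-- Residues

residue-unique : ∀ {q a b} → a < q → b < q → + q ∣ℤ + a ℤ.- + b → a ≡ b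
residue-unique {q} {a} {b} a<q b<q q∣a-b =
  ℤ.+-injective (ℤ.i-j≡0⇒i≡j (+ a) (+ b) (ℤ.∣i∣≡0⇒i≡0 (small _ ∣a-b∣<q (∣ℤ.∣⇒∣ᵤ q∣a-b))))
  where
  ∣a-b∣<q : ℤ.∣ + a ℤ.- + b ∣ < q
  ∣a-b∣<q = subst (λ i → ℤ.∣ i ∣ < q) (sym (ℤ.m-n≡m⊖n a b))
    (≤-<-trans (ℤ.∣m⊝n∣≤m⊔n a b) (⊔-pres-<m a<q b<q))
  small : ∀ m → m < q → q ∣ m → m ≡ 0
  small zero    _   _   = refl
  small (suc m) m<q q∣m = contradiction (∣⇒≤ q∣m) (<⇒≱ m<q)

congruent⇔ : ∀ q a b → .{{_ : NonZero q}} → + q ∣ℤ + a ℤ.- + b ⇔ a % q ≡ b % q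
congruent⇔ q a b = mk⇔
  (λ q∣a-b → residue-unique (m%n<n a q) (m%n<n b q)
    (subst (+ q ∣ℤ_) (sym remainders) (∣ℤ.∣m∣n⇒∣m-n q∣a-b (divides (+ (a / q) ℤ.- + (b / q)) refl))))
  (λ eq → divides (+ (a / q) ℤ.- + (b / q)) (begin
    + a ℤ.- + b
      ≡⟨ cong₂ ℤ._-_ (expand a) (expand b) ⟩
    (+ (a % q) ℤ.+ + (a / q) ℤ.* + q) ℤ.- (+ (b % q) ℤ.+ + (b / q) ℤ.* + q)
      ≡⟨ cong (λ r → (+ r ℤ.+ + (a / q) ℤ.* + q) ℤ.- (+ (b % q) ℤ.+ + (b / q) ℤ.* + q)) eq ⟩
    (+ (b % q) ℤ.+ + (a / q) ℤ.* + q) ℤ.- (+ (b % q) ℤ.+ + (b / q) ℤ.* + q)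
      ≡⟨ cancel (+ (b % q)) (+ (a / q)) (+ (b / q)) (+ q) ⟩
    (+ (a / q) ℤ.- + (b / q)) ℤ.* + q ∎))
  where
  open ≡-Reasoning
  expand : ∀ a → + a ≡ + (a % q) ℤ.+ + (a / q) ℤ.* + q
  expand a = trans (cong +_ (m≡m%n+[m/n]*n a q))
    (trans (ℤ.pos-+ (a % q) _) (cong (ℤ._+_ (+ (a % q))) (ℤ.pos-* (a / q) q)))
  cancel : ∀ r x y q → (r ℤ.+ x ℤ.* q) ℤ.+ ℤ.- (r ℤ.+ y ℤ.* q) ≡ (x ℤ.+ ℤ.- y) ℤ.* q
  cancel = solve-∀
  remainders : + (a % q) ℤ.- + (b % q) ≡ (+ a ℤ.- + b) ℤ.- (+ (a / q) ℤ.- + (b / q)) ℤ.* + q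
  remainders = trans (rearrange (+ (a % q)) (+ (b % q)) (+ (a / q)) (+ (b / q)) (+ q))
    (cong₂ (λ i j → (i ℤ.- j) ℤ.- (+ (a / q) ℤ.- + (b / q)) ℤ.* + q) (sym (expand a)) (sym (expand b)))
    where
    rearrange : ∀ r s x y q → r ℤ.+ ℤ.- s ≡
      ((r ℤ.+ x ℤ.* q) ℤ.+ ℤ.- (s ℤ.+ y ℤ.* q)) ℤ.+ ℤ.- ((x ℤ.+ ℤ.- y) ℤ.* q)
    rearrange = solve-∀

m+n≡r⇒r-n≡m : ∀ {m n r} → m + n ≡ r → + r ℤ.- + n ≡ + m
m+n≡r⇒r-n≡m {m} {n} refl = trans (cong (ℤ._- + n) (ℤ.pos-+ m n)) (cancel (+ m) (+ n))
  where
  cancel : ∀ x y → (x ℤ.+ y) ℤ.+ ℤ.- y ≡ x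
  cancel = solve-∀

-- Counting flows

classIndicator : {V : Set} → (V → ℕ) → V → V → ℤ
classIndicator ρ u x with ρ x ≟ ρ u
... | yes _ = 1ℤ
... | no  _ = 0ℤ

module _ {V : Set} (ρ : V → ℕ) (u : V) where

  classIndicator-∈ : ∀ {x} → ρ x ≡ ρ u → classIndicator ρ u x ≡ 1ℤ
  classIndicator-∈ {x} eq with ρ x ≟ ρ u
  ... | yes _ = refl
  ... | no ¬p = contradiction eq ¬p

  classIndicator-∉ : ∀ {x} → ρ x ≢ ρ u → classIndicator ρ u x ≡ 0ℤ
  classIndicator-∉ {x} neq with ρ x ≟ ρ u
  ... | yes p = contradiction p neq
  ... | no  _ = refl

  classIndicator-respects : Respects ρ (classIndicator ρ u)
  classIndicator-respects {x} {y} eq with ρ y ≟ ρ u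
  ... | yes p = classIndicator-∈ (trans eq p)
  ... | no ¬p = classIndicator-∉ (λ p → ¬p (trans (sym eq) p))

module _ {V : Set} (p : ℕ) where

  private
    q = suc p

  -- The pairing of an assignment with the coboundary of a vertex potential φ.
  pairing : (V → ℤ) → (es : List (V × V)) → Vec (Fin q) (length es) → ℤ
  pairing φ []             []      = 0ℤ
  pairing φ ((u , v) ∷ es) (a ∷ k) = + toℕ a ℤ.* (φ v ℤ.- φ u) ℤ.+ pairing φ es k

  pairing-linear : ∀ (φ ψ : V → ℤ) c es k →
    pairing (λ x → φ x ℤ.+ c ℤ.* ψ x) es k ≡ pairing φ es k ℤ.+ c ℤ.* pairing ψ es k
  pairing-linear φ ψ c []             []      = sym (trans (ℤ.+-identityˡ _) (ℤ.*-zeroʳ c))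
  pairing-linear φ ψ c ((u , v) ∷ es) (a ∷ k) = trans
    (cong (ℤ._+_ (+ toℕ a ℤ.* ((φ v ℤ.+ c ℤ.* ψ v) ℤ.- (φ u ℤ.+ c ℤ.* ψ u)))) (pairing-linear φ ψ c es k))
    (lemma (+ toℕ a) (φ u) (φ v) (ψ u) (ψ v) c (pairing φ es k) (pairing ψ es k))
    where
    lemma : ∀ a φu φv ψu ψv c s t →
      a ℤ.* ((φv ℤ.+ c ℤ.* ψv) ℤ.+ ℤ.- (φu ℤ.+ c ℤ.* ψu)) ℤ.+ (s ℤ.+ c ℤ.* t) ≡
      (a ℤ.* (φv ℤ.+ ℤ.- φu) ℤ.+ s) ℤ.+ c ℤ.* (a ℤ.* (ψv ℤ.+ ℤ.- ψu) ℤ.+ t)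
    lemma = solve-∀

  pairing-constant : ∀ {φ : V → ℤ} {u v} → φ u ≡ φ v → ∀ es a k →
                     pairing φ ((u , v) ∷ es) (a ∷ k) ≡ pairing φ es k
  pairing-constant {φ} {u} {v} eq es a k = trans
    (cong (λ d → + toℕ a ℤ.* d ℤ.+ pairing φ es k) (ℤ.i≡j⇒i-j≡0 (sym eq)))
    (trans (cong (ℤ._+ pairing φ es k) (ℤ.*-zeroʳ (+ toℕ a))) (ℤ.+-identityˡ _))

  -- Flow conservation, tested against all potentials instead of at each vertex:
  -- contracting an edge then only shrinks the space of test functions.
  Conserves : (V → ℕ) → (es : List (V × V)) → Vec (Fin q) (length es) → Set
  Conserves ρ es k = ∀ (φ : V → ℤ) → Respects ρ φ → + q ∣ℤ pairing φ es k

  -- The net flow of the listed edges into the class of `u`.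
  defect : (V → ℕ) → V → (es : List (V × V)) → Vec (Fin q) (length es) → ℤ
  defect ρ u es k = pairing (classIndicator ρ u) es k

  Conserves-loop : ∀ (ρ : V → ℕ) {u v} es a k → ρ u ≡ ρ v →
                   Conserves ρ ((u , v) ∷ es) (a ∷ k) ⇔ Conserves ρ es k
  Conserves-loop ρ es a k loop = mk⇔
    (λ cons φ φ-resp → subst (+ q ∣ℤ_) (pairing-constant (φ-resp loop) es a k) (cons φ φ-resp))
    (λ cons φ φ-resp → subst (+ q ∣ℤ_) (sym (pairing-constant (φ-resp loop) es a k)) (cons φ φ-resp))

  -- Conservation at the class of `u` forces the value on an edge leaving it. Conversely, any
  -- potential becomes constant across the edge after adding a multiple of the indicator of that
  -- class, so this one congruence and the potentials of the contracted graph generate all tests.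
  Conserves-∷ : ∀ (ρ : V → ℕ) {u v} es a k → ρ u ≢ ρ v →
                Conserves ρ ((u , v) ∷ es) (a ∷ k) ⇔
                (Conserves (merge ρ u v) es k × + q ∣ℤ defect ρ u es k ℤ.- + toℕ a)
  Conserves-∷ ρ {u} {v} es a k u≁v = mk⇔ to from
    where
    δ = classIndicator ρ u
    D = defect ρ u es k
    A′ = + toℕ a
    δu≡1 : δ u ≡ 1ℤ
    δu≡1 = classIndicator-∈ ρ u refl
    δv≡0 : δ v ≡ 0ℤ
    δv≡0 = classIndicator-∉ ρ u (≢-sym u≁v)

    to : Conserves ρ ((u , v) ∷ es) (a ∷ k) → Conserves (merge ρ u v) es k × + q ∣ℤ D ℤ.- A′
    to cons = (λ φ φ-resp → subst (+ q ∣ℤ_) (pairing-constant {φ = φ} (φ-resp (merge-joins ρ u v)) es a k)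
                 (cons φ (λ eq → φ-resp (merge-coarser ρ u v eq))))
            , subst (+ q ∣ℤ_)
                (trans (cong₂ (λ i j → A′ ℤ.* (i ℤ.- j) ℤ.+ D) δv≡0 δu≡1) (lemma A′ D))
                (cons δ (classIndicator-respects ρ u))
      where
      lemma : ∀ a d → a ℤ.* (0ℤ ℤ.+ ℤ.- 1ℤ) ℤ.+ d ≡ d ℤ.+ ℤ.- a
      lemma = solve-∀

    from : Conserves (merge ρ u v) es k × + q ∣ℤ D ℤ.- A′ → Conserves ρ ((u , v) ∷ es) (a ∷ k)
    from (cons , q∣D-a) φ φ-resp = subst (+ q ∣ℤ_)
      (trans (cong (ℤ._- c ℤ.* (D ℤ.- A′)) (pairing-linear φ δ c es k)) (lemma A′ c D (pairing φ es k)))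
      (∣ℤ.∣m∣n⇒∣m-n (cons ψ (merge-least ρ u v ψ-resp ψu≡ψv)) (∣ℤ.∣n⇒∣m*n c q∣D-a))
      where
      c = φ v ℤ.- φ u
      ψ : V → ℤ
      ψ x = φ x ℤ.+ c ℤ.* δ x
      ψ-resp : Respects ρ ψ
      ψ-resp eq = cong₂ (λ i j → i ℤ.+ c ℤ.* j) (φ-resp eq) (classIndicator-respects ρ u eq)
      ψu≡ψv : ψ u ≡ ψ v
      ψu≡ψv = trans (cong (λ i → φ u ℤ.+ c ℤ.* i) δu≡1)
        (trans (balance (φ u) (φ v)) (cong (λ i → φ v ℤ.+ c ℤ.* i) (sym δv≡0)))
        where
        balance : ∀ x y → x ℤ.+ (y ℤ.+ ℤ.- x) ℤ.* 1ℤ ≡ y ℤ.+ (y ℤ.+ ℤ.- x) ℤ.* 0ℤ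
        balance = solve-∀
      lemma : ∀ a c d s → (s ℤ.+ c ℤ.* d) ℤ.+ ℤ.- (c ℤ.* (d ℤ.+ ℤ.- a)) ≡ a ℤ.* c ℤ.+ s
      lemma = solve-∀

  -- The definition quantifies over infinitely many potentials; the recursion along the edges
  -- reduces it to one divisibility for each non-loop.
  conserves? : ∀ (ρ : V → ℕ) es k → Dec (Conserves ρ es k)
  conserves? ρ []             []      = yes (λ _ _ → divides 0ℤ refl)
  conserves? ρ ((u , v) ∷ es) (a ∷ k) with ρ u ≟ ρ v
  ... | yes loop = map′ (Equivalence.from (Conserves-loop ρ es a k loop))
                        (Equivalence.to (Conserves-loop ρ es a k loop))
                        (conserves? ρ es k)
  ... | no u≁v = map′ (Equivalence.from (Conserves-∷ ρ es a k u≁v))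
                      (Equivalence.to (Conserves-∷ ρ es a k u≁v))
                      (conserves? (merge ρ u v) es k ×-dec (+ q ∣? (defect ρ u es k ℤ.- + toℕ a)))

  NowhereZero : ∀ {m} → Vec (Fin q) m → Set
  NowhereZero k = ∀ e → toℕ (Vec.lookup k e) ≢ 0

  nowhereZero? : ∀ {m} (k : Vec (Fin q) m) → Dec (NowhereZero k)
  nowhereZero? k = Fin.all? (λ e → ¬? (toℕ (Vec.lookup k e) ≟ 0))

  NowhereZeroFlow : (V → ℕ) → (es : List (V × V)) → Vec (Fin q) (length es) → Set
  NowhereZeroFlow ρ es k = NowhereZero k × Conserves ρ es k

  nowhereZeroFlow? : ∀ ρ es k → Dec (NowhereZeroFlow ρ es k)
  nowhereZeroFlow? ρ es k = nowhereZero? k ×-dec conserves? ρ es k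

  #flows : (V → ℕ) → List (V × V) → ℕ
  #flows ρ es = count (nowhereZeroFlow? ρ es) (allVectors q (length es))

  -- The value on the first edge may be zero. With the other values fixed, the admissible values
  -- there are then all residues, exactly one, or none.
  AlmostFlow : (V → ℕ) → ∀ e es → Vec (Fin q) (length es) → Fin q → Set
  AlmostFlow ρ e es k a = NowhereZero k × Conserves ρ (e ∷ es) (a ∷ k)

  almostFlow? : ∀ ρ e es k a → Dec (AlmostFlow ρ e es k a)
  almostFlow? ρ e es k a = nowhereZero? k ×-dec conserves? ρ (e ∷ es) (a ∷ k)

  Conserves-0∷ : ∀ (ρ : V → ℕ) e es k → Conserves ρ (e ∷ es) (Fin.zero ∷ k) ⇔ Conserves ρ es k
  Conserves-0∷ ρ e es k = mk⇔
    (λ cons φ φ-resp → subst (+ q ∣ℤ_) (ℤ.+-identityˡ _) (cons φ φ-resp))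
    (λ cons φ φ-resp → subst (+ q ∣ℤ_) (sym (ℤ.+-identityˡ _)) (cons φ φ-resp))

  -- The counts on the two sides differ only at the value 0: the nowhere-zero condition rejects it
  -- for `e ∷ es`, while an almost-flow with value 0 is the same as a flow of the deleted graph.
  count-first : ∀ ρ e es k →
    count (λ a → nowhereZeroFlow? ρ (e ∷ es) (a ∷ k)) (allFin q) + indicator (nowhereZeroFlow? ρ es k) ≡
    count (almostFlow? ρ e es k) (allFin q)
  count-first ρ e es k = begin
    count flow? (allFin q) + i            ≡⟨ cong (_+ i) (count-∷ flow? Fin.zero nonzeros) ⟩
    indicator (flow? Fin.zero) + count flow? nonzeros + i
      ≡⟨ cong (λ b → (if b then 1 else 0) + count flow? nonzeros + i)
           (dec-false (flow? Fin.zero) (λ (nz , _) → nz Fin.zero refl)) ⟩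
    count flow? nonzeros + i              ≡⟨ +-comm _ i ⟩
    i + count flow? nonzeros              ≡⟨ cong₂ _+_
        (cong (λ b → if b then 1 else 0) (does-⇔ zero⇔ (nowhereZeroFlow? ρ es k) (almost? Fin.zero)))
        nonzeros-same ⟩
    indicator (almost? Fin.zero) + count almost? nonzeros ≡⟨ count-∷ almost? Fin.zero nonzeros ⟨
    count almost? (allFin q) ∎
    where
    open ≡-Reasoning
    flow? : (a : Fin q) → Dec (NowhereZeroFlow ρ (e ∷ es) (a ∷ k))
    flow? a = nowhereZeroFlow? ρ (e ∷ es) (a ∷ k)
    almost? = almostFlow? ρ e es k
    i = indicator (nowhereZeroFlow? ρ es k)
    nonzeros = tabulate {n = p} Fin.suc
    zero⇔ : NowhereZeroFlow ρ es k ⇔ AlmostFlow ρ e es k Fin.zero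
    zero⇔ = mk⇔ (λ (nz , cons) → nz , Equivalence.from (Conserves-0∷ ρ e es k) cons)
                (λ (nz , cons) → nz , Equivalence.to (Conserves-0∷ ρ e es k) cons)
    suc⇔ : ∀ b → NowhereZeroFlow ρ (e ∷ es) (Fin.suc b ∷ k) ⇔ AlmostFlow ρ e es k (Fin.suc b)
    suc⇔ b = mk⇔ (λ (nz , cons) → (λ e → nz (Fin.suc e)) , cons)
                 (λ (nz , cons) → (λ { Fin.zero () ; (Fin.suc e) → nz e }) , cons)
    nonzeros-same : count flow? nonzeros ≡ count almost? nonzeros
    nonzeros-same = begin
      count flow? (tabulate Fin.suc)              ≡⟨ cong (count flow?) (map-tabulate id Fin.suc) ⟨
      count flow? (map Fin.suc (allFin p))        ≡⟨ count-map flow? Fin.suc (allFin p) ⟩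
      count (λ b → flow? (Fin.suc b)) (allFin p)  ≡⟨ count-cong (λ b → flow? (Fin.suc b)) (λ b → almost? (Fin.suc b))
                                                      (λ b → does-⇔ (suc⇔ b) (flow? (Fin.suc b)) (almost? (Fin.suc b))) (allFin p) ⟩
      count (λ b → almost? (Fin.suc b)) (allFin p) ≡⟨ count-map almost? Fin.suc (allFin p) ⟨
      count almost? (map Fin.suc (allFin p))      ≡⟨ cong (count almost?) (map-tabulate id Fin.suc) ⟩
      count almost? (tabulate Fin.suc) ∎

  #flows-∷ : ∀ ρ e es → #flows ρ (e ∷ es) + #flows ρ es ≡
             sum (map (λ k → count (almostFlow? ρ e es k) (allFin q)) (allVectors q (length es)))
  #flows-∷ ρ e es = begin
    #flows ρ (e ∷ es) + #flows ρ es
      ≡⟨ cong₂ _+_ (count-cartesianProductWith (nowhereZeroFlow? ρ (e ∷ es)) _∷_ (allFin q) ks)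
                   (sym (trans (sum-map-cong (λ k → sym (*-identityˡ _)) ks)
                     (trans (sum-indicator (nowhereZeroFlow? ρ es) 1 ks) (*-identityˡ _)))) ⟩
    sum (map firsts ks) + sum (map (λ k → indicator (nowhereZeroFlow? ρ es k)) ks)
      ≡⟨ sum-map-+ firsts (λ k → indicator (nowhereZeroFlow? ρ es k)) ks ⟨
    sum (map (λ k → firsts k + indicator (nowhereZeroFlow? ρ es k)) ks)
      ≡⟨ sum-map-cong (count-first ρ e es) ks ⟩
    sum (map (λ k → count (almostFlow? ρ e es k) (allFin q)) ks) ∎
    where
    open ≡-Reasoning
    ks = allVectors q (length es)
    firsts : Vec (Fin q) (length es) → ℕ
    firsts k = count (λ a → nowhereZeroFlow? ρ (e ∷ es) (a ∷ k)) (allFin q)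

  #flows-loop : ∀ (ρ : V → ℕ) {u v} es → ρ u ≡ ρ v →
                #flows ρ ((u , v) ∷ es) + #flows ρ es ≡ q * #flows ρ es
  #flows-loop ρ {u} {v} es loop = trans (#flows-∷ ρ (u , v) es)
    (trans (sum-map-cong fibre (allVectors q (length es)))
      (sum-indicator (nowhereZeroFlow? ρ es) q (allVectors q (length es))))
    where
    fibre : ∀ k → count (almostFlow? ρ (u , v) es k) (allFin q) ≡ q * indicator (nowhereZeroFlow? ρ es k)
    fibre k = indicator-cases (nowhereZeroFlow? ρ es k)
      (λ (nz , cons) → trans (count-all (almostFlow? ρ (u , v) es k)
        (λ a → nz , Equivalence.from (Conserves-loop ρ es a k loop) cons) (allFin q))
        (length-tabulate {n = q} id))
      (λ ¬flow → count-none (almostFlow? ρ (u , v) es k)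
        (λ a (nz , cons) → ¬flow (nz , Equivalence.to (Conserves-loop ρ es a k loop) cons)) (allFin q))

  #flows-merge : ∀ (ρ : V → ℕ) {u v} es → ρ u ≢ ρ v →
                 #flows ρ ((u , v) ∷ es) + #flows ρ es ≡ #flows (merge ρ u v) es
  #flows-merge ρ {u} {v} es u≁v = trans (#flows-∷ ρ (u , v) es)
    (trans (sum-map-cong fibre (allVectors q (length es)))
      (trans (sum-indicator (nowhereZeroFlow? (merge ρ u v) es) 1 (allVectors q (length es))) (*-identityˡ _)))
    where
    fibre : ∀ k → count (almostFlow? ρ (u , v) es k) (allFin q) ≡ 1 * indicator (nowhereZeroFlow? (merge ρ u v) es k)
    fibre k = indicator-cases (nowhereZeroFlow? (merge ρ u v) es k)
      (λ (nz , cons) → count-unique (almostFlow? ρ (u , v) es k) (allFin⁺ q) (∈-allFin a)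
        (nz , Equivalence.from (Conserves-∷ ρ es a k u≁v) (cons , q∣D-a))
        (λ {b} (_ , consᵇ) → Fin.toℕ-injective (residue-unique (Fin.toℕ<n b) (Fin.toℕ<n a)
          (subst (+ q ∣ℤ_) (difference D (+ toℕ a) (+ toℕ b))
            (∣ℤ.∣m∣n⇒∣m-n q∣D-a (proj₂ (Equivalence.to (Conserves-∷ ρ es b k u≁v) consᵇ)))))))
      (λ ¬flow → count-none (almostFlow? ρ (u , v) es k)
        (λ a (nz , cons) → ¬flow (nz , proj₁ (Equivalence.to (Conserves-∷ ρ es a k u≁v) cons))) (allFin q))
      where
      D = defect ρ u es k
      -- The forced value on the edge: the residue of the net flow that the other edges bring into
      -- the class of `u`.
      a = fromℕ< (n%ℕd<d D q)
      q∣D-a : + q ∣ℤ D ℤ.- + toℕ a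
      q∣D-a = divides (D /ℕ q) (trans (cong (λ r → D ℤ.- + r) (Fin.toℕ-fromℕ< (n%ℕd<d D q)))
        (trans (cong (ℤ._- + (D %ℕ q)) (a≡a%ℕn+[a/ℕn]*n D q)) (cancel (+ (D %ℕ q)) (D /ℕ q ℤ.* + q))))
        where
        cancel : ∀ r x → (r ℤ.+ x) ℤ.+ ℤ.- r ≡ x
        cancel = solve-∀
      difference : ∀ d a b → (d ℤ.+ ℤ.- a) ℤ.+ ℤ.- (d ℤ.+ ℤ.- b) ≡ b ℤ.+ ℤ.- a
      difference = solve-∀

  eval-flowPolynomial : ∀ ρ es → eval (flowPolynomial ρ es) (+ q) ≡ + #flows ρ es
  eval-flowPolynomial ρ [] = cong (λ i → 1ℤ ℤ.+ i) (ℤ.*-zeroʳ (+ q))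
  eval-flowPolynomial ρ ((u , v) ∷ es) with ρ u ≟ ρ v in eq
  ... | yes loop = begin
    eval ([x-1] P) (+ q)                              ≡⟨ eval-⊖ (0ℤ ∷ P) P (+ q) ⟩
    (0ℤ ℤ.+ + q ℤ.* eval P (+ q)) ℤ.- eval P (+ q)    ≡⟨ cong (λ i → (0ℤ ℤ.+ + q ℤ.* i) ℤ.- i) (eval-flowPolynomial ρ es) ⟩
    (0ℤ ℤ.+ + q ℤ.* + n) ℤ.- + n                      ≡⟨ cong (ℤ._- + n) (trans (ℤ.+-identityˡ _) (sym (ℤ.pos-* q n))) ⟩
    + (q * n) ℤ.- + n                                 ≡⟨ m+n≡r⇒r-n≡m (#flows-loop ρ es loop) ⟩
    + #flows ρ ((u , v) ∷ es) ∎
    where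
    open ≡-Reasoning
    P = flowPolynomial ρ es
    n = #flows ρ es
  ... | no u≁v = begin
    eval (flowPolynomial (merge ρ u v) es ⊖ flowPolynomial ρ es) (+ q)
      ≡⟨ eval-⊖ (flowPolynomial (merge ρ u v) es) (flowPolynomial ρ es) (+ q) ⟩
    eval (flowPolynomial (merge ρ u v) es) (+ q) ℤ.- eval (flowPolynomial ρ es) (+ q)
      ≡⟨ cong₂ ℤ._-_ (eval-flowPolynomial (merge ρ u v) es) (eval-flowPolynomial ρ es) ⟩
    + #flows (merge ρ u v) es ℤ.- + #flows ρ es
      ≡⟨ m+n≡r⇒r-n≡m (#flows-merge ρ es u≁v) ⟩
    + #flows ρ ((u , v) ∷ es) ∎
    where
    open ≡-Reasoning

-- From potentials back to conservation at vertices

vertexIndicator : ∀ {n} → Fin n → Fin n → ℤ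
vertexIndicator v x = if does (x Fin.≟ v) then 1ℤ else 0ℤ

module _ (p : ℕ) {n : ℕ} where

  private
    q = suc p
    graph : List (Fin n × Fin n) → Graph
    graph es = record { order = n ; edges = es }

  pairing-vertexIndicator : ∀ v es k → pairing p (vertexIndicator v) es k ≡
                            + inflow (graph es) q k v ℤ.- + outflow (graph es) q k v
  pairing-vertexIndicator v []             []      = refl
  pairing-vertexIndicator v ((u , w) ∷ es) (a ∷ k) = begin
    + toℕ a ℤ.* (ℤ[ w ] ℤ.- ℤ[ u ]) ℤ.+ pairing p (vertexIndicator v) es k
      ≡⟨ cong (ℤ._+_ (+ toℕ a ℤ.* (ℤ[ w ] ℤ.- ℤ[ u ]))) (pairing-vertexIndicator v es k) ⟩
    + toℕ a ℤ.* (ℤ[ w ] ℤ.- ℤ[ u ]) ℤ.+ (+ inᵏ ℤ.- + outᵏ)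
      ≡⟨ lemma (+ toℕ a) ℤ[ u ] ℤ[ w ] (+ inᵏ) (+ outᵏ) ⟩
    (+ toℕ a ℤ.* ℤ[ w ] ℤ.+ + inᵏ) ℤ.- (+ toℕ a ℤ.* ℤ[ u ] ℤ.+ + outᵏ)
      ≡⟨ cong₂ (λ i j → (i ℤ.+ + inᵏ) ℤ.- (j ℤ.+ + outᵏ)) (scale (does (w Fin.≟ v))) (scale (does (u Fin.≟ v))) ⟩
    + inflow (graph ((u , w) ∷ es)) q (a ∷ k) v ℤ.- + outflow (graph ((u , w) ∷ es)) q (a ∷ k) v ∎
    where
    open ≡-Reasoning
    ℤ[_] = vertexIndicator v
    inᵏ = inflow (graph es) q k v
    outᵏ = outflow (graph es) q k v
    scale : ∀ b → + toℕ a ℤ.* (if b then 1ℤ else 0ℤ) ≡ + (if b then toℕ a else 0)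
    scale true  = ℤ.*-identityʳ (+ toℕ a)
    scale false = ℤ.*-zeroʳ (+ toℕ a)
    lemma : ∀ a x y i o → a ℤ.* (y ℤ.+ ℤ.- x) ℤ.+ (i ℤ.+ ℤ.- o) ≡ (a ℤ.* y ℤ.+ i) ℤ.+ ℤ.- (a ℤ.* x ℤ.+ o)
    lemma = solve-∀

  -- Vertex indicators span the potentials. The number `m` bounds the support of `φ`, and each step
  -- clears the value at the last vertex of it by subtracting a multiple of its indicator.
  conserved-at-vertices⇒∣pairing : ∀ es k → (∀ v → + q ∣ℤ pairing p (vertexIndicator v) es k) →
    ∀ m → m ≤ n → (φ : Fin n → ℤ) → (∀ x → m ≤ toℕ x → φ x ≡ 0ℤ) → + q ∣ℤ pairing p φ es k
  conserved-at-vertices⇒∣pairing es k cons zero    _   φ φ≡0 =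
    divides 0ℤ (pairing-0 es k)
    where
    pairing-0 : ∀ es k → pairing p φ es k ≡ 0ℤ
    pairing-0 []             []      = refl
    pairing-0 ((u , v) ∷ es) (a ∷ k) = trans
      (pairing-constant p {φ = φ} (trans (φ≡0 u z≤n) (sym (φ≡0 v z≤n))) es a k) (pairing-0 es k)
  conserved-at-vertices⇒∣pairing es k cons (suc m) m<n φ φ≡0 = ∣ℤ.∣m+n∣n⇒∣m {m = pairing p φ es k}
    (subst (+ q ∣ℤ_) (pairing-linear p φ (vertexIndicator v) (ℤ.- φ v) es k)
      (conserved-at-vertices⇒∣pairing es k cons m (<⇒≤ m<n) ψ ψ≡0))
    (∣ℤ.∣n⇒∣m*n (ℤ.- φ v) (cons v))
    where
    v = fromℕ< m<n
    ψ : Fin n → ℤ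
    ψ x = φ x ℤ.+ (ℤ.- φ v) ℤ.* vertexIndicator v x
    ψ≡0 : ∀ x → m ≤ toℕ x → ψ x ≡ 0ℤ
    ψ≡0 x m≤x with x Fin.≟ v
    ... | yes refl = trans (cong (λ i → φ v ℤ.+ i) (ℤ.*-identityʳ _)) (ℤ.+-inverseʳ (φ v))
    ... | no x≢v   = trans (cong₂ ℤ._+_ (φ≡0 x (≤∧≢⇒< m≤x m≢x)) (ℤ.*-zeroʳ (ℤ.- φ v))) refl
      where
      m≢x : m ≢ toℕ x
      m≢x eq = x≢v (Fin.toℕ-injective (trans (sym eq) (sym (Fin.toℕ-fromℕ< m<n))))

  Conserves⇔balanced : ∀ es k → Conserves p toℕ es k ⇔
                       (∀ v → inflow (graph es) q k v % q ≡ outflow (graph es) q k v % q)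
  Conserves⇔balanced es k = mk⇔
    (λ cons v → Equivalence.to (congruent⇔ q (inflow (graph es) q k v) (outflow (graph es) q k v))
      (subst (+ q ∣ℤ_) (pairing-vertexIndicator v es k)
        (cons (vertexIndicator v) (λ {x} {y} eq → cong (vertexIndicator v) (Fin.toℕ-injective {i = x} {j = y} eq)))))
    (λ bal φ _ → conserved-at-vertices⇒∣pairing es k
      (λ v → subst (+ q ∣ℤ_) (sym (pairing-vertexIndicator v es k))
        (Equivalence.from (congruent⇔ q (inflow (graph es) q k v) (outflow (graph es) q k v)) (bal v)))
      n ≤-refl φ (λ x n≤x → contradiction (Fin.toℕ<n x) (≤⇒≯ n≤x)))

  #flows≡#nowhereZeroFlows : ∀ es → #flows p toℕ es ≡ #nowhereZeroFlows (graph es) q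
  #flows≡#nowhereZeroFlows es = count-cong (nowhereZeroFlow? p toℕ es) (isNowhereZeroFlow? (graph es) q)
    (λ k → does-⇔ (mk⇔ (λ (nz , cons) → nz , Equivalence.to (Conserves⇔balanced es k) cons)
                        (λ (nz , bal) → nz , Equivalence.from (Conserves⇔balanced es k) bal))
             (nowhereZeroFlow? p toℕ es k) (isNowhereZeroFlow? (graph es) q k))
    (allVectors q (length es))

flowPolynomial-isFlowPolynomial : ∀ n (es : List (Fin n × Fin n)) →
  IsFlowPolynomial (record { order = n ; edges = es }) (flowPolynomial toℕ es)
flowPolynomial-isFlowPolynomial n es (suc p) = trans (eval-flowPolynomial p toℕ es)
  (cong +_ (#flows≡#nowhereZeroFlows p es))

corollary2 : (n : ℕ) → 2 < n →
    let N = n * (n ∸ 1) / 2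
        N′ = (n ∸ 1) * (n ∸ 2) / 2
    in (∃[ F ] IsFlowPolynomial (K n) F) ×
       (∀ F → IsFlowPolynomial (K n) F →
         HasDegree F N′ ×
         (∀ k → k ≤ n ∸ 3 →
           coefficient F (N′ ∸ k) ≡ (-1ℤ ℤ.^ k) ℤ.* (+ (N C k))))
corollary2 n@(suc (suc (suc m))) 2<n@(s≤s (s≤s (s≤s z≤n))) = (P , P-flow) , λ F F-flow →
  let F≗P = coefficients-unique F P (λ q → trans (F-flow q) (sym (P-flow q))) in
  ((λ eq → 1≢0 (trans (sym (top 0 z≤n)) (trans (sym (F≗P N′)) eq))) ,
   λ i N′<i → trans (F≗P i) (degree≤nullity toℕ es i (subst (_< i) N′≡ν N′<i))) ,
  λ k k≤m → trans (F≗P (N′ ∸ k)) (top k k≤m)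
  where
  es = KEdges n
  P = flowPolynomial toℕ es
  P-flow : IsFlowPolynomial (K n) P
  P-flow = flowPolynomial-isFlowPolynomial n es
  N = n * (n ∸ 1) / 2
  N′ = (n ∸ 1) * (n ∸ 2) / 2
  N′≡ν : N′ ≡ nullity toℕ es
  N′≡ν = nullity-K n (<⇒≤ 2<n)
  -- Makes the truncated `N′ ∸ k` a true difference for every `k ≤ m`.
  m≤N′ : m ≤ N′
  m≤N′ = subst (_≤ N′) (m*n/n≡m m 2)
    (/-monoˡ-≤ 2 (≤-trans (*-mono-≤ (n≤1+n m) (s≤s (s≤s (z≤n {m})))) (≤-reflexive (*-comm (suc m) (2 + m)))))
  1≢0 : 1ℤ ≢ 0ℤ
  1≢0 ()
  top : ∀ k → k ≤ m → coefficient P (N′ ∸ k) ≡ (-1ℤ ℤ.^ k) ℤ.* (+ (N C k))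
  top k k≤m = trans
    -- Here `m` is n - 3, and the cuts of K_n have at least `2 + m` edges, exactly the connectivity
    -- required.
    (top-coefficient toℕ es m (K-edgeConnected (suc (suc m))) k (N′ ∸ k) k≤m
      (trans (m∸n+n≡m (≤-trans k≤m m≤N′)) N′≡ν))
    (cong (λ N → signedBinomial N k) (sym (size-K n)))
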